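{- Fix an $\mathbf{FO}^2$ sentence $\Gamma$ in Scott normal form. For every finite non-empty domain $\Delta$, the Two-Stage Compilation algorithm equipped with the subcircuit-reuse optimizations (both described in the context), run on $\Gamma$ and $\Delta$, runs in time $O\big((|C|+1)\,|\Delta|^2\big)$, where $|C|$ is the size (number of edges) of the output circuit produced by the optimized algorithm, and the constant hidden in $O(\cdot)$ depends only on $\Gamma$.
   Context: Logic. First-order logic is function-free, constant-free and without equality. Vocabularies are finite, with predicates of arity 1 or 2, and domains are finite and non-empty; $\Delta=\{e_1,\dots,e_n\}$. $\Gamma$ is in Scott normal form: $\Gamma=\forall x\forall y:\phi(x,y)\wedge\bigwedge_{k\in[m]}\forall x\exists y:\beta_k(x,y)$, with $\phi$ quantifier-free with variables among $x,y$ and each $\beta_k(x,y)$ a single binary atom. Types. A unary type $\tau$ is a maximally consistent set of literals over the atoms $P(x)$ ($P$ unary in $\Gamma$) and $R(x,x)$ ($R$ binary in $\Gamma$). A binary type $\pi$ is a maximally consistent set of literals over the atoms $R(x,y),R(y,x)$ ($R$ binary in $\Gamma$). Types are identified with the conjunctions $\tau(x)$, $\pi(x,y)$ of their literals. $\tau$ is valid if $\tau(x)\models\phi(x,x)$; $\mathcal U$ is the set of valid unary types and $q=|\mathcal U|$. For $\tau,\tau'\in\mathcal U$, $\mathcal B(\tau,\tau')$ is the set of binary types $\pi$ with $\tau(x)\wedge\tau'(y)\wedge\pi(x,y)\models\phi(x,y)\wedge\phi(y,x)$. Algorithm. A context $\theta$ is the conjunction of the ground type formulas chosen so far along the current recursion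 branch. $\textsc{Extendable}(\theta)$ holds iff there is a model $\mathcal A$ over $\Delta$ with $\mathcal A\models\Gamma\wedge\theta$. $\textsc{Or}(S)$ and $\textsc{And}(S)$ create an $\vee$-node (resp. $\wedge$-node) with children $S$; empty $\textsc{Or}$ is $\bot$ and empty $\textsc{And}$ is $\top$. Two-Stage Compilation returns $\textsc{Stage-I}(1,\top)$, where: - $\textsc{Stage-I}(i,\theta)$: if $i=n+1$, return $\textsc{Stage-II}((1,2),\theta)$. Otherwise return $\textsc{Or}$ of the set of all nodes $\textsc{And}(\textsc{And}(\tau(e_i)),\textsc{Stage-I}(i+1,\theta\wedge\tau(e_i)))$, over all $\tau\in\mathcal U$ for which $\textsc{Extendable}(\theta\wedge\tau(e_i))$ holds, where $\textsc{And}(\tau(e_i))$ is the $\wedge$-node over the literals of $\tau(e_i)$. - $\textsc{Stage-II}((i,j),\theta)$: if $i=n$, return $\top$. Otherwise let $\tau_i,\tau_j$ be the unary types assigned to $e_i,e_j$ in $\theta$ and return $\textsc{Or}$ of the set of all nodes $\textsc{And}(\textsc{And}(\pi(e_i,e_j)),\textsc{Stage-II}(\mathrm{next}(i,j),\theta\wedge\pi(e_i,e_j)))$, over all $\pi\in\mathcal B(\tau_i,\tau_j)$ for which $\textsc{Extendable}(\theta\wedge\pi(e_i,e_j))$ holds. Here $\mathrm{next}(i,j)=(i,j+1)$ if $j<n$ and $(i+1,i+2)$ if $j=n$. Optimizations (reuse of subcircuits). - Within a call $\textsc{Stage-I}(i,\theta)$, if two unary types $\tau,\tau'\in\mathcal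 U$ have the same abstraction, meaning that $\beta_k(x,x)\in\tau$ iff $\beta_k(x,x)\in\tau'$ for all $k\in[m]$, and $\mathcal B(\tau,\tau'')=\mathcal B(\tau',\tau'')$ for all $\tau''\in\mathcal U$, then the subcircuit computed for $\theta\wedge\tau(e_i)$ is reused for $\theta\wedge\tau'(e_i)$ instead of making a second recursive call. - For each pair $(i,j)$ a hash table stores the subcircuits already returned by calls $\textsc{Stage-II}((i,j),\cdot)$. The key of a context $\theta$ consists of the satisfaction state $S_\theta$ (the $n\times m$ Boolean matrix with $S_\theta(\ell,k)=\mathrm{True}$ iff $\theta\models\beta_k(e_\ell,e_t)$ for some $e_t\in\Delta$) together with the sets $\mathcal B(\tau_\ell,\tau_t)$ for all unprocessed pairs $(e_\ell,e_t)$ ($\ell<t$, $(\ell,t)$ lexicographically at least $(i,j)$), where $\tau_\ell,\tau_t$ are the unary types of $e_\ell,e_t$ in $\theta$. When a call is generated whose key is already present, the stored subcircuit is reused and the call is not executed. Computing, looking up and inserting a key is counted as time linear in the size of the data recorded. Implementation of $\textsc{Extendable}$. For an $\mathbf{FO}^2$ sentence with an ordered list of $q$ valid unary types, a configuration is a vector $\mathbf n\in\mathbb N^q$, with $|\mathbf n|=\sum_i n_i$. It is satisfiable if the sentence has a model (over a non-empty domain) in which exactly $n_i$ elements realize the $i$-th type for all $i$. Known fact (may be used): for a Scott-normal-form sentence with $m$ existential conjuncts and $\delta=\max\{m(m+1),2m+1\}$, $\mathbf n$ is satisfiable iff there is a satisfiable $\mathbf n'\in\{0,\dots,\delta\}^q$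 such that for all $i$, $n'_i=0\Rightarrow n_i=0$ and $n'_i>0\Rightarrow n'_i\le n_i$. The finite set of satisfiable bounded vectors (templates) is precomputed once for the fixed sentence. - In Stage I, with $\hat{\mathbf n}$ the vector counting how many processed elements have each unary type in $\theta$, the test checks whether some template $\mathbf n'$ of $\Gamma$ satisfies $n'_i=0\Rightarrow\hat n_i=0$ for all $i$ and $n-|\hat{\mathbf n}|\ge\sum_i\max\{n'_i-\hat n_i,0\}$. - In Stage II, after a binary type for $(e_i,e_j)$ has been added to $\theta$, the test uses the auxiliary sentence (with fresh predicates $T,Q,Z_1,\dots,Z_m$ unary and $D$ binary) $\Gamma_{\mathrm{aux}}=\forall x\forall y:\phi(x,y)\wedge\forall x\forall y:(T(x)\wedge Q(y)\to D(x,y)\wedge D(y,x))\wedge\forall x\forall y:(D(x,y)\to((T(x)\wedge Q(y))\vee(T(y)\wedge Q(x))))\wedge\bigwedge_{k\in[m]}\forall x:(Z_k(x)\to\exists y:\beta_k(x,y)\wedge\neg D(x,y))$ (put into Scott normal form). It decides, by comparison with the templates of $\Gamma_{\mathrm{aux}}$, whether the following configuration over $\{e_i,\dots,e_n\}$ is satisfiable: each element has its unary type from $\theta$, $T$ holds exactly at $e_i$, $Q$ holds exactly at $e_i,\dots,e_j$, $D(e,e)$ holds exactly for $e=e_i$, and $Z_k(e)$ holds iff $\theta\not\models\exists y:\beta_k(e,y)$. Known fact (may be used): this configuration is satisfiable iff $\theta$ is extendable. Each test thus takes a constant number (for fixed $\Gamma$) of arithmetic operations on counters bounded by $n$, i.e.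 $O(\log n)$ time. -}

module Defs where

open import Data.Bool using (Bool; true; false; not; _∧_; _∨_; if_then_else_)
import Data.Bool.Properties as Bool
open import Data.Fin using (Fin; fromℕ<; _↑ˡ_; _↑ʳ_)
import Data.Fin as Fin
import Data.Fin.Properties as Fin
open import Data.Bool.ListAction using (any)
open import Data.List using (List; []; _∷_; length; map; filter; allFin;
  cartesianProduct; cartesianProductWith; upTo)
import Data.List as List
import Data.List.Properties as List
open import Data.List.Membership.Propositional using (_∈_; find; lose)
open import Data.List.Membership.Propositional.Properties
  using (∈-cartesianProduct⁺; ∈-cartesianProductWith⁺)
open import Data.List.Relation.Unary.Any using (here; there; any?)
open import Data.Maybe using (Maybe; just; nothing)
open import Data.Nat using (ℕ; zero; suc; _+_; _*_; _∸_; _⊔_; _<_; _≡ᵇ_; _≤ᵇ_;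
  NonZero; nonZero?; z<s)
import Data.Nat as ℕ
import Data.Nat.Properties as ℕ
open import Data.Nat.ListAction using (sum)
open import Data.Nat.Logarithm using (⌊log₂_⌋)
open import Data.Product using (Σ; ∃; _×_; _,_; proj₁; proj₂)
import Data.Product.Properties as Product
open import Data.Unit using (⊤; tt)
open import Data.Vec using (Vec; []; _∷_; lookup; tabulate; toList; fromList; _∷ʳ_; cast)
import Data.Vec as Vec
import Data.Vec.Properties as Vec
open import Function using (_∘_)
open import Relation.Binary.Definitions using (DecidableEquality)
open import Relation.Binary.PropositionalEquality using (_≡_; refl; sym; trans; subst)
open import Relation.Nullary using (Dec; does)
open import Relation.Nullary.Decidable using (map′; _×-dec_)

record Vocabulary : Set where
  constructor ⟨_,_⟩
  field
    unary binary : ℕ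

open Vocabulary public

data Var : Set where
  𝑥 𝑦 : Var

record BinaryAtom (V : Vocabulary) (A : Set) : Set where
  constructor _[_,_]
  field
    symbol      : Fin (binary V)
    left right  : A

data Atom (V : Vocabulary) (A : Set) : Set where
  pred : Fin (unary V) → A → Atom V A
  rel  : BinaryAtom V A → Atom V A

mapBinary : ∀ {V A B} → (A → B) → BinaryAtom V A → BinaryAtom V B
mapBinary f (R [ a , b ]) = R [ f a , f b ]

mapAtom : ∀ {V A B} → (A → B) → Atom V A → Atom V B
mapAtom f (pred P a) = pred P (f a)
mapAtom f (rel α)    = rel (mapBinary f α)

infixr 7 _`∧_
infixr 6 _`∨_
infixr 5 _`⇒_

data Formula (V : Vocabulary) : Set where
  atom      : Atom V Var → Formula V
  `true     : Formula V
  `¬_       : Formula V → Formula V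
  _`∧_ _`∨_ : Formula V → Formula V → Formula V

_`⇒_ : ∀ {V} → Formula V → Formula V → Formula V
φ `⇒ ψ = `¬ φ `∨ ψ

eval : ∀ {V} → (Atom V Var → Bool) → Formula V → Bool
eval v (atom α)  = v α
eval v `true     = true
eval v (`¬ φ)    = not (eval v φ)
eval v (φ `∧ ψ)  = eval v φ ∧ eval v ψ
eval v (φ `∨ ψ)  = eval v φ ∨ eval v ψ

-- ∀x∀y φ(x,y) ∧ ⋀ₖ ∀x∃y βₖ(x,y)
record ScottNF : Set where
  field
    vocabulary : Vocabulary
    φ          : Formula vocabulary
    m          : ℕ
    β          : Fin m → BinaryAtom vocabulary Var

⟦_,_⟧ : ∀ {A : Set} → A → A → Var → A
⟦ a , b ⟧ 𝑥 = a
⟦ a , b ⟧ 𝑦 = b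

Structure : Vocabulary → ℕ → Set
Structure V N = Vec (Vec Bool N) (unary V) × Vec (Vec (Vec Bool N) N) (binary V)

holds : ∀ {V N} → Structure V N → Atom V (Fin N) → Bool
holds (Ps , Rs) (pred P a)        = lookup (lookup Ps P) a
holds (Ps , Rs) (rel (R [ a , b ])) = lookup (lookup (lookup Rs R) a) b

_⊨_ : ∀ {N} (let open ScottNF) → (Γ : ScottNF) → Structure (vocabulary Γ) N → Set
_⊨_ {N} Γ 𝔄 =
  ((a b : Fin N) → eval (holds 𝔄 ∘ mapAtom ⟦ a , b ⟧) φ ≡ true) ×
  ((k : Fin m) (a : Fin N) → ∃ λ b → holds 𝔄 (rel (mapBinary ⟦ a , b ⟧ (β k))) ≡ true)
  where open ScottNF Γ

-- A maximally consistent set of literals is a truth assignment to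
-- the atoms involved.

-- Truth values of P(x) and of R(x,x).
UnaryType : Vocabulary → Set
UnaryType V = Vec Bool (unary V) × Vec Bool (binary V)

-- Truth values of R(x,y) and of R(y,x).
BinaryType : Vocabulary → Set
BinaryType V = Vec Bool (binary V) × Vec Bool (binary V)

_≟ᵘ_ : ∀ {V} → DecidableEquality (UnaryType V)
_≟ᵘ_ = Product.≡-dec (Vec.≡-dec Bool._≟_) (Vec.≡-dec Bool._≟_)

_≟ᵇ_ : ∀ {V} → DecidableEquality (BinaryType V)
_≟ᵇ_ = Product.≡-dec (Vec.≡-dec Bool._≟_) (Vec.≡-dec Bool._≟_)

-- All variables denote one element of type τ.
value₁ : ∀ {V A} → UnaryType V → Atom V A → Bool
value₁ (ps , rs) (pred P _)        = lookup ps P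
value₁ (ps , rs) (rel (R [ _ , _ ])) = lookup rs R

-- x has type τ, y has type τ′, and the pair (x,y) has type π.
value₂ : ∀ {V} → UnaryType V → UnaryType V → BinaryType V → Atom V Var → Bool
value₂ τ τ′ π (pred P 𝑥)         = value₁ τ (pred P 𝑥)
value₂ τ τ′ π (pred P 𝑦)         = value₁ τ′ (pred P 𝑦)
value₂ τ τ′ π (rel α@(_ [ 𝑥 , 𝑥 ])) = value₁ τ (rel α)
value₂ τ τ′ π (rel α@(_ [ 𝑦 , 𝑦 ])) = value₁ τ′ (rel α)
value₂ τ τ′ π (rel (R [ 𝑥 , 𝑦 ])) = lookup (proj₁ π) R
value₂ τ τ′ π (rel (R [ 𝑦 , 𝑥 ])) = lookup (proj₂ π) R

typeOf : ∀ {V N} → Structure V N → Fin N → UnaryType V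
typeOf 𝔄 a = tabulate (λ P → holds 𝔄 (pred P a)) , tabulate (λ R → holds 𝔄 (rel (R [ a , a ])))

vectors : ∀ {A : Set} → List A → (k : ℕ) → List (Vec A k)
vectors as zero    = [] ∷ []
vectors as (suc k) = cartesianProductWith _∷_ as (vectors as k)

bits : (k : ℕ) → List (Vec Bool k)
bits = vectors (false ∷ true ∷ [])

-- A type decides every atom of the formulas below, so that it entails them
-- exactly when it makes them true.
module Types (Γ : ScottNF) where
  open ScottNF Γ

  Valid : UnaryType vocabulary → Set
  Valid τ = eval (value₁ τ) φ ≡ true

  Admissible : (τ τ′ : UnaryType vocabulary) → BinaryType vocabulary → Set
  Admissible τ τ′ π =
    eval (value₂ τ τ′ π) φ ≡ true × eval (value₂ τ τ′ π ∘ mapAtom ⟦ 𝑦 , 𝑥 ⟧) φ ≡ true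

  𝓤 : List (UnaryType vocabulary)
  𝓤 = filter valid? (cartesianProduct (bits (unary vocabulary)) (bits (binary vocabulary)))
    where
    valid? : ∀ τ → Dec (Valid τ)
    valid? τ = _ Bool.≟ true

  q : ℕ
  q = length 𝓤

  -- Listed in a fixed order, so that equality of lists is equality of sets.
  𝓑 : (τ τ′ : UnaryType vocabulary) → List (BinaryType vocabulary)
  𝓑 τ τ′ = filter admissible? (cartesianProduct (bits (binary vocabulary)) (bits (binary vocabulary)))
    where
    admissible? : ∀ π → Dec (Admissible τ τ′ π)
    admissible? π = (_ Bool.≟ true) ×-dec (_ Bool.≟ true)

vectors-complete : ∀ {A : Set} {as : List A} → (∀ a → a ∈ as) →
                ∀ {k} (v : Vec A k) → v ∈ vectors as k
vectors-complete all []      = here refl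
vectors-complete all (a ∷ v) = ∈-cartesianProductWith⁺ _∷_ (all a) (vectors-complete all v)

Bool-complete : ∀ b → b ∈ (false ∷ true ∷ [])
Bool-complete false = here refl
Bool-complete true  = there (here refl)

structures : ∀ V N → List (Structure V N)
structures V N = cartesianProduct (vectors (bits N) (unary V))
                                  (vectors (vectors (bits N) N) (binary V))

structures-complete : ∀ {V N} (𝔄 : Structure V N) → 𝔄 ∈ structures V N
structures-complete (Ps , Rs) = ∈-cartesianProduct⁺
  (vectors-complete (vectors-complete Bool-complete) Ps)
  (vectors-complete (vectors-complete (vectors-complete Bool-complete)) Rs)

_⊨?_ : ∀ {N} (let open ScottNF) (Γ : ScottNF) (𝔄 : Structure (vocabulary Γ) N) → Dec (Γ ⊨ 𝔄)
Γ ⊨? 𝔄 = Fin.all? (λ a → Fin.all? λ b → _ Bool.≟ true) ×-dec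
          Fin.all? (λ k → Fin.all? λ a → Fin.any? λ b → _ Bool.≟ true)

module Configurations (Γ : ScottNF) where
  open ScottNF Γ
  open Types Γ

  Configuration : Set
  Configuration = Vec ℕ q

  configurationOf : List (UnaryType vocabulary) → Configuration
  configurationOf τs = Vec.map (λ τ → length (filter (τ ≟ᵘ_) τs)) (fromList 𝓤)

  -- Every element of a model realizes a valid type, hence the domain of a
  -- model realizing 𝐧 has size |𝐧|.
  Satisfiable : Configuration → Set
  Satisfiable 𝐧 = NonZero (Vec.sum 𝐧) × Σ (Structure vocabulary (Vec.sum 𝐧)) λ 𝔄 →
    Γ ⊨ 𝔄 × configurationOf (map (typeOf 𝔄) (allFin _)) ≡ 𝐧

  satisfiable? : ∀ 𝐧 → Dec (Satisfiable 𝐧)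
  satisfiable? 𝐧 = nonZero? (Vec.sum 𝐧) ×-dec
    map′ (λ p → let 𝔄 , _ , r = find p in 𝔄 , r)
         (λ (𝔄 , r) → lose (structures-complete 𝔄) r)
         (any? (λ 𝔄 → (Γ ⊨? 𝔄) ×-dec Vec.≡-dec ℕ._≟_ _ _) (structures vocabulary _))

  δ : ℕ
  δ = (m * (m + 1)) ⊔ (2 * m + 1)

  templates : List Configuration
  templates = filter satisfiable? (vectors (upTo (suc δ)) q)

module _ (Γ : ScottNF) where
  open ScottNF Γ

  auxVocabulary : Vocabulary
  auxVocabulary = ⟨ unary vocabulary + (2 + m) , binary vocabulary + (1 + m) ⟩

  private
    T Q : Var → Formula auxVocabulary
    T v = atom (pred (unary vocabulary ↑ʳ Fin.zero) v)
    Q v = atom (pred (unary vocabulary ↑ʳ Fin.suc Fin.zero) v)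

    Z : Fin m → Var → Formula auxVocabulary
    Z k v = atom (pred (unary vocabulary ↑ʳ Fin.suc (Fin.suc k)) v)

    D : Var → Var → Formula auxVocabulary
    D v w = atom (rel ((binary vocabulary ↑ʳ Fin.zero) [ v , w ]))

    E : Fin m → BinaryAtom auxVocabulary Var
    E k = (binary vocabulary ↑ʳ Fin.suc k) [ 𝑥 , 𝑦 ]

    embedBinary : BinaryAtom vocabulary Var → BinaryAtom auxVocabulary Var
    embedBinary (R [ v , w ]) = (R ↑ˡ (1 + m)) [ v , w ]

    embed : Formula vocabulary → Formula auxVocabulary
    embed (atom (pred P v)) = atom (pred (P ↑ˡ (2 + m)) v)
    embed (atom (rel α))    = atom (rel (embedBinary α))
    embed `true             = `true
    embed (`¬ ψ)            = `¬ embed ψ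
    embed (ψ `∧ χ)          = embed ψ `∧ embed χ
    embed (ψ `∨ χ)          = embed ψ `∨ embed χ

    -- ∀x (Zₖ(x) → ∃y (βₖ(x,y) ∧ ¬D(x,y))) is brought into Scott normal form
    -- as ∀x∃y Eₖ(x,y), where Eₖ(x,y) abbreviates Zₖ(x) → βₖ(x,y) ∧ ¬D(x,y).
    witness : Fin m → Formula auxVocabulary
    witness k = (atom (rel (E k)) `⇒ ψ) `∧ (ψ `⇒ atom (rel (E k)))
      where
      ψ : Formula auxVocabulary
      ψ = Z k 𝑥 `⇒ (atom (rel (embedBinary (β k))) `∧ `¬ D 𝑥 𝑦)

  Γ-aux : ScottNF
  Γ-aux = record
    { vocabulary = auxVocabulary
    ; φ = embed φ
        `∧ (T 𝑥 `∧ Q 𝑦 `⇒ D 𝑥 𝑦 `∧ D 𝑦 𝑥)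
        `∧ (D 𝑥 𝑦 `⇒ (T 𝑥 `∧ Q 𝑦) `∨ (T 𝑦 `∧ Q 𝑥))
        `∧ List.foldr _`∧_ `true (map witness (allFin m))
    ; m = m
    ; β = E
    }

  -- The unary type of Γ-aux extending τ with the given truth values of
  -- T(x), Q(x), D(x,x), Zₖ(x); those of Eₖ(x,x) are then determined.
  auxType : UnaryType vocabulary → (t q d : Bool) → (Fin m → Bool) → UnaryType auxVocabulary
  auxType τ@(ps , rs) t q d z =
    ps Vec.++ (t ∷ q ∷ tabulate z) ,
    rs Vec.++ (d ∷ tabulate (λ k → not (z k) ∨ (value₁ τ (rel (β k)) ∧ not d)))

data Child (V : Vocabulary) (n : ℕ) : Set where
  literal : Bool → Atom V (Fin n) → Child V n
  gate    : ℕ → Child V n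

data Gate (V : Vocabulary) (n : ℕ) : Set where
  and or : List (Child V n) → Gate V n

children : ∀ {V n} → Gate V n → List (Child V n)
children (and cs) = cs
children (or cs)  = cs

-- Gates are listed in reverse order of creation: the gate at the head of
-- g ∷ gs has identifier length gs.  Children are created before parents.
record Circuit (V : Vocabulary) (n : ℕ) : Set where
  constructor circuit
  field
    gates  : List (Gate V n)
    output : ℕ

gateIds : ∀ {V n} → List (Child V n) → List ℕ
gateIds []                 = []
gateIds (literal _ _ ∷ cs) = gateIds cs
gateIds (gate i ∷ cs)      = i ∷ gateIds cs

-- The number of edges leaving gates reachable from the given identifiers.
edgesFrom : ∀ {V n} → List ℕ → List (Gate V n) → ℕ
edgesFrom ids []       = 0
edgesFrom ids (g ∷ gs) =
  if any (length gs ≡ᵇ_) ids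
  then length (children g) + edgesFrom (gateIds (children g) List.++ ids) gs
  else edgesFrom ids gs

size : ∀ {V n} → Circuit V n → ℕ
size (circuit gates output) = edgesFrom (output ∷ []) gates

-- The machine-dependent constants of the cost measure; none depends on n.
record Costs : Set where
  field
    setup      : ℕ  -- everything precomputed from the sentence alone
    step       : ℕ  -- a control step, or writing one gate or one edge
    arith      : ℕ  -- an arithmetic operation, per bit of the counters
    record-bit : ℕ  -- computing, looking up or inserting a key, per bit recorded

module Compilation (Γ : ScottNF) (κ : Costs) (n : ℕ) where
  open ScottNF Γ
  open Types Γ
  open Costs κ
  open Configurations

  Δ : List (Fin n)
  Δ = allFin n

  Type : Set
  Type = UnaryType vocabulary

  Pair : Set
  Pair = Fin n × Fin n

  -- All pairs i < j, in lexicographic order.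
  pairs : List Pair
  pairs = filter (λ (i , j) → i Fin.<? j) (cartesianProduct Δ Δ)

  -- A Stage II context: the unary types of all elements, and the binary
  -- types chosen so far.
  record Context : Set where
    constructor _&_
    field
      types : Vec Type n
      links : List (Pair × BinaryType vocabulary)

  open Context

  -- θ is a consistent conjunction of ground literals, so it entails a ground
  -- atom exactly when it contains it, and entails ∃y βₖ(e,y) exactly when it
  -- entails βₖ(e,e′) for some e′.
  entails : Context → BinaryAtom vocabulary (Fin n) → Bool
  entails θ (R [ a , b ]) =
    (does (a Fin.≟ b) ∧ value₁ (lookup (types θ) a) (rel (R [ a , a ]))) ∨
    any (λ ((i , j) , (fwd , bwd)) →
           (does (a Fin.≟ i) ∧ does (b Fin.≟ j) ∧ lookup fwd R) ∨
           (does (a Fin.≟ j) ∧ does (b Fin.≟ i) ∧ lookup bwd R))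
        (links θ)

  satisfied : Context → Fin n → Fin m → Bool
  satisfied θ e k = any (λ e′ → entails θ (mapBinary ⟦ e , e′ ⟧ (β k))) Δ

  -- Keys.  Contexts waiting at different pairs (i,j) have different unprocessed
  -- pairs, so one table of keys represents the family of tables.
  record Key : Set where
    constructor key
    field
      state : Vec (Vec Bool m) n
      sets  : List (Pair × List (BinaryType vocabulary))

  keyOf : List Pair → Context → Key
  keyOf unprocessed θ = key
    (tabulate λ e → tabulate λ k → satisfied θ e k)
    (map (λ (i , j) → (i , j) , 𝓑 (lookup (types θ) i) (lookup (types θ) j)) unprocessed)

  _≟ᵏ_ : DecidableEquality Key
  key S s ≟ᵏ key S′ s′ =
    map′ (λ { (refl , refl) → refl }) (λ { refl → refl , refl })
      (Vec.≡-dec (Vec.≡-dec Bool._≟_) S S′ ×-dec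
       List.≡-dec (Product.≡-dec (Product.≡-dec Fin._≟_ Fin._≟_) (List.≡-dec (_≟ᵇ_ {vocabulary}))) s s′)

  keySize : Key → ℕ
  keySize (key _ sets) =
    n * m + sum (map (λ (_ , πs) → 1 + length πs * (2 * binary vocabulary)) sets)

  record State : Set where
    constructor state
    field
      gates : List (Gate vocabulary n)
      table : List (Key × ℕ)
      time  : ℕ

  open State public

  M : Set → Set
  M A = State → A × State

  return : ∀ {A} → A → M A
  return a s = a , s

  infixl 1 _>>=_ _>>_

  _>>=_ : ∀ {A B} → M A → (A → M B) → M B
  (p >>= f) s = let a , s′ = p s in f a s′

  _>>_ : ∀ {A B} → M A → M B → M B
  p >> p′ = p >>= λ _ → p′

  tick : ℕ → M ⊤
  tick t s = tt , record s { time = t + time s }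

  operation : ∀ {A} → A → M A
  operation a = do
    tick (arith * suc ⌊log₂ n ⌋)
    return a

  newGate : Gate vocabulary n → M ℕ
  newGate g = do
    tick (step * suc (length (children g)))
    λ s → length (gates s) , record s { gates = g ∷ gates s }

  allM anyM : ∀ {A : Set} → (A → M Bool) → List A → M Bool
  allM p []       = return true
  allM p (a ∷ as) = do
    b  ← p a
    bs ← allM p as
    return (b ∧ bs)
  anyM p []       = return false
  anyM p (a ∷ as) = do
    b  ← p a
    bs ← anyM p as
    return (b ∨ bs)

  -- The counters are maintained incrementally: extending the context by one
  -- type takes a bounded number of operations on each of them.
  counters : ∀ {k} → Vec ℕ k → M (Vec ℕ k)
  counters []       = return []
  counters (c ∷ cs) = do
    c  ← operation c
    cs ← counters cs
    return (c ∷ cs)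

  total : List ℕ → M ℕ
  total []       = return 0
  total (c ∷ cs) = do
    s ← total cs
    operation (c + s)

  -- Below, a list of pairs aligns a template with a configuration.

  deficit : List (ℕ × ℕ) → M ℕ
  deficit []             = return 0
  deficit ((t , c) ∷ ps) = do
    d ← operation (t ∸ c)
    s ← deficit ps
    operation (d + s)

  supports : ℕ × ℕ → M Bool
  supports (t , c) = do
    t≡0 ← operation (t ≡ᵇ 0)
    if t≡0 then operation (c ≡ᵇ 0) else return true

  covers : ℕ × ℕ → M Bool
  covers (t , c) = do
    t≡0 ← operation (t ≡ᵇ 0)
    if t≡0 then operation (c ≡ᵇ 0) else operation (t ≤ᵇ c)

  extendableI : List Type → M Bool
  extendableI τs = do
    n̂ ← counters (configurationOf Γ τs)
    anyM (λ n′ → do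
            let aligned = toList (Vec.zip n′ n̂)
            s ← allM supports aligned
            p ← total (toList n̂)
            d ← deficit aligned
            r ← operation (n ∸ p)
            e ← operation (d ≤ᵇ r)
            return (s ∧ e))
         (templates Γ)

  -- The configuration over eᵢ, …, eₙ once a binary type of (eᵢ,eⱼ) is in θ.
  auxTypes : Context → Pair → List (UnaryType (auxVocabulary Γ))
  auxTypes θ (i , j) = map
    (λ e → auxType Γ (lookup (types θ) e) (does (e Fin.≟ i)) (does (e Fin.≤? j))
                     (does (e Fin.≟ i)) (λ k → not (satisfied θ e k)))
    (filter (i Fin.≤?_) Δ)

  extendableII : Context → Pair → M Bool
  extendableII θ ij = do
    c ← counters (configurationOf (Γ-aux Γ) (auxTypes θ ij))
    anyM (λ n′ → allM covers (toList (Vec.zip n′ c))) (templates (Γ-aux Γ))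

  unaryLiterals : Fin n → Type → List (Child vocabulary n)
  unaryLiterals e (ps , rs) =
    map (λ P → literal (lookup ps P) (pred P e)) (allFin _) List.++
    map (λ R → literal (lookup rs R) (rel (R [ e , e ]))) (allFin _)

  binaryLiterals : Pair → BinaryType vocabulary → List (Child vocabulary n)
  binaryLiterals (i , j) (fwd , bwd) =
    map (λ R → literal (lookup fwd R) (rel (R [ i , j ]))) (allFin _) List.++
    map (λ R → literal (lookup bwd R) (rel (R [ j , i ]))) (allFin _)

  -- The node And(And(ls), s).
  branch : List (Child vocabulary n) → ℕ → M ℕ
  branch ls s = do
    l ← newGate (and ls)
    newGate (and (gate l ∷ gate s ∷ []))

  Abstraction : Set
  Abstraction = Vec Bool m × List (List (BinaryType vocabulary))

  abstraction : Type → Abstraction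
  abstraction τ = tabulate (λ k → value₁ τ (rel (β k))) , map (𝓑 τ) 𝓤

  _≟ᵃ_ : DecidableEquality Abstraction
  _≟ᵃ_ = Product.≡-dec (Vec.≡-dec Bool._≟_) (List.≡-dec (List.≡-dec (_≟ᵇ_ {vocabulary})))

  findReusable : Type → List (Type × ℕ) → M (Maybe ℕ)
  findReusable τ []               = return nothing
  findReusable τ ((τ′ , s) ∷ done) = do
    tick step
    if does (abstraction τ ≟ᵃ abstraction τ′) then return (just s) else findReusable τ done

  module _ (test : Type → M Bool) (recurse : Type → M ℕ)
           (literals : Type → List (Child vocabulary n)) where

    -- The last argument holds the types already expanded in this call, with
    -- their subcircuits.
    branchesI : List Type → List (Type × ℕ) → M (List (Child vocabulary n))
    branchesI []       done = return []
    branchesI (τ ∷ τs) done = do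
      tick step
      extendable ← test τ
      if extendable then expand else branchesI τs done
      where
      subcircuit : Maybe ℕ → M ℕ
      subcircuit (just s) = return s
      subcircuit nothing  = recurse τ

      expand : M (List (Child vocabulary n))
      expand = do
        reusable ← findReusable τ done
        s  ← subcircuit reusable
        b  ← branch (literals τ) s
        bs ← branchesI τs ((τ , s) ∷ done)
        return (gate b ∷ bs)

  module _ (test : BinaryType vocabulary → M Bool) (recurse : BinaryType vocabulary → M ℕ)
           (literals : BinaryType vocabulary → List (Child vocabulary n)) where

    branchesII : List (BinaryType vocabulary) → M (List (Child vocabulary n))
    branchesII []       = return []
    branchesII (π ∷ πs) = do
      tick step
      extendable ← test π
      if extendable then expand else branchesII πs
      where
      expand : M (List (Child vocabulary n))
      expand = do
        s  ← recurse π
        b  ← branch (literals π) s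
        bs ← branchesII πs
        return (gate b ∷ bs)

  lookupKey : Key → List (Key × ℕ) → Maybe ℕ
  lookupKey k []             = nothing
  lookupKey k ((k′ , s) ∷ t) = if does (k ≟ᵏ k′) then just s else lookupKey k t

  -- Computes the key and performs the lookup; the table is a hash table, so
  -- the cost does not depend on the number of entries.
  retrieve : Key → M (Maybe ℕ)
  retrieve k = do
    tick (record-bit * suc (keySize k))
    λ s → lookupKey k (table s) , s

  store : Key → ℕ → M ⊤
  store k i = do
    tick (record-bit * suc (keySize k))
    λ s → tt , record s { table = (k , i) ∷ table s }

  -- Stage II at (i,j) is given by the list of unprocessed pairs, whose head is
  -- (i,j) and whose tail starts with next(i,j); it is empty once i = n.
  mutual
    callII : List Pair → Context → M ℕ
    callII unprocessed θ = do
      let k = keyOf unprocessed θ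
      found ← retrieve k
      reuse k found
      where
      reuse : Key → Maybe ℕ → M ℕ
      reuse k (just s) = return s
      reuse k nothing  = do
        s ← stageII unprocessed θ
        store k s
        return s

    stageII : List Pair → Context → M ℕ
    stageII []                      θ = do
      tick step
      newGate (and [])
    stageII ((i , j) ∷ unprocessed) θ = do
      tick step
      bs ← branchesII (λ π → extendableII (extend π) (i , j))
                      (λ π → callII unprocessed (extend π))
                      (binaryLiterals (i , j))
                      (𝓑 (lookup (types θ) i) (lookup (types θ) j))
      newGate (or bs)
      where
      extend : BinaryType vocabulary → Context
      extend π = types θ & (((i , j) , π) ∷ links θ)

  -- i elements are processed and r remain.
  stageI : ∀ {i} (r : ℕ) → i + r ≡ n → Vec Type i → M ℕ
  stageI {i} zero    eq θ = do
    tick step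
    callII pairs (cast (trans (sym (ℕ.+-identityʳ i)) eq) θ & [])
  stageI {i} (suc r) eq θ = do
    tick step
    bs ← branchesI (λ τ → extendableI (toList (θ ∷ʳ τ)))
                   (λ τ → stageI r (trans (sym (ℕ.+-suc i r)) eq) (θ ∷ʳ τ))
                   (unaryLiterals (fromℕ< (subst (i <_) eq (ℕ.m<m+n i z<s))))
                   𝓤 []
    newGate (or bs)

  result : ℕ × State
  result = (do tick setup
               stageI n refl []) (state [] [] 0)

  outputCircuit : Circuit vocabulary n
  outputCircuit = circuit (gates (proj₂ result)) (proj₁ result)

  runningTime : ℕ
  runningTime = time (proj₂ result)

-- Whatever the Extendable tests answer, every gate created becomes, directly or through reuse,
-- a child of a later gate or the output. Hence all gates are reachable from the output, and
-- |C| counts all edges ever written. Amortise: each generated call costs O(n²) beyond the calls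
-- that it generates, the dominant part being the key, and is charged to the two edges of the
-- And node consuming its result; the initial call accounts for the "+ 1".

module Submission where

open import Data.Bool using (Bool; true; false; if_then_else_)
import Data.Bool.Properties as Bool
open import Data.Bool.ListAction using (any)
open import Data.List using (List; []; _∷_; [_]; _++_; length; map;
  cartesianProduct; cartesianProductWith)
import Data.List.Properties as List
open import Data.List.Membership.Propositional using (_∈_; lose)
open import Data.List.Relation.Binary.Subset.Propositional using (_⊆_)
open import Data.List.Relation.Binary.Subset.Propositional.Properties
  using (⊆-refl; ⊆-trans; ⊆-reflexive-↭; ++⁺ʳ; xs⊆ys++xs; xs⊆x∷xs)
open import Data.List.Relation.Binary.Permutation.Propositional.Properties using (shift)
open import Data.List.Relation.Unary.Any using (here; there)
import Data.List.Relation.Unary.Any.Properties as Any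
open import Data.Maybe using (just; nothing)
open import Data.Nat using (ℕ; zero; suc; z≤n; _+_; _*_; _^_; _≤_; _≡ᵇ_; _≤ᵇ_; NonZero)
open import Data.Nat.ListAction using (sum)
open import Data.Nat.Logarithm using (⌊log₂_⌋; ⌊log₂⌋-mono-≤; ⌊log₂[2^n]⌋≡n)
open import Data.Nat.Properties
open import Data.Nat.Tactic.RingSolver using (solve-∀)
open import Data.Product using (∃-syntax; _×_; _,_; proj₁; proj₂)
open import Data.Unit using (⊤; tt)
open import Data.Vec using (Vec; []; _∷_; toList; _∷ʳ_; lookup)
import Data.Vec as Vec
import Data.Vec.Properties as Vec
open import Function using (_∘_; const; Equivalence)
open import Relation.Nullary using (does)
open import Relation.Binary.PropositionalEquality using (_≡_; refl; sym; trans; cong; cong₂)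
open import Defs

private variable
  A B : Set
  V : Vocabulary
  n : ℕ

-- Reachability and the number of edges.

edges : List (Gate V n) → ℕ
edges gs = sum (map (length ∘ children) gs)

-- The recursion follows that of edgesFrom, with every test answered positively.
AllReachable : List ℕ → List (Gate V n) → Set
AllReachable ids []       = ⊤
AllReachable ids (g ∷ gs) = length gs ∈ ids × AllReachable (gateIds (children g) ++ ids) gs

AllReachable-⊆ : ∀ {ids ids′} (gs : List (Gate V n)) →
                 ids ⊆ ids′ → AllReachable ids gs → AllReachable ids′ gs
AllReachable-⊆ []       ids⊆ids′ _              = tt
AllReachable-⊆ (g ∷ gs) ids⊆ids′ (g∈ids , rest) =
  ids⊆ids′ g∈ids , AllReachable-⊆ gs (++⁺ʳ (gateIds (children g)) ids⊆ids′) rest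

any-≡ᵇ : ∀ {i ids} → i ∈ ids → any (i ≡ᵇ_) ids ≡ true
any-≡ᵇ {i} i∈ids =
  Equivalence.to Bool.T-≡ (Any.any⁺ (i ≡ᵇ_) (lose i∈ids (≡⇒≡ᵇ i i refl)))

-- No gate is skipped by the traversal, so the size of the output circuit can be read off the gate
-- list, a quantity that grows predictably with each gate created.
edgesFrom-AllReachable : ∀ {ids} (gs : List (Gate V n)) →
                         AllReachable ids gs → edgesFrom ids gs ≡ edges gs
edgesFrom-AllReachable []       _ = refl
edgesFrom-AllReachable (g ∷ gs) (g∈ids , rest) rewrite any-≡ᵇ g∈ids =
  cong (length (children g) +_) (edgesFrom-AllReachable gs rest)

-- Elementary bounds.

n≤2^n : ∀ n → n ≤ 2 ^ n
n≤2^n zero    = z≤n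
n≤2^n (suc n) = +-mono-≤ (m^n>0 2 n) (≤-trans (n≤2^n n) (m≤m+n _ 0))

⌊log₂n⌋≤n : ∀ n → ⌊log₂ n ⌋ ≤ n
⌊log₂n⌋≤n n = ≤-trans (⌊log₂⌋-mono-≤ (n≤2^n n)) (≤-reflexive (⌊log₂[2^n]⌋≡n n))

sum-map-≤ : ∀ {b} (f : A → ℕ) (as : List A) → (∀ a → f a ≤ b) → sum (map f as) ≤ length as * b
sum-map-≤ f []       f≤b = z≤n
sum-map-≤ f (a ∷ as) f≤b = +-mono-≤ (f≤b a) (sum-map-≤ f as f≤b)

length-cartesianProductWith : ∀ {C : Set} (f : A → B → C) as bs →
  length (cartesianProductWith f as bs) ≡ length as * length bs
length-cartesianProductWith f []       bs = refl
length-cartesianProductWith f (a ∷ as) bs =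
  trans (List.length-++ (map (f a) bs))
        (cong₂ _+_ (List.length-map (f a) bs) (length-cartesianProductWith f as bs))

-- Costs are in units of n².
module Overheads (Γ : ScottNF) (κ : Costs) where
  open ScottNF Γ
  open Costs κ
  open Types Γ using (q)
  open Types (Γ-aux Γ) using () renaming (q to q′)
  open Configurations using (templates)

  -- Each constant bounds only what a procedure does not charge to edges. In particular
  -- `stageIICost` contains no term for the recursive calls, so no recurrence has to be solved.
  operationCost keyCost testICost testIICost binaryTypes stageIICost callIICost stageICost : ℕ
  operationCost = arith * 2
  testICost = q * operationCost + length (templates Γ) *
    (q * (operationCost + operationCost) + (q * operationCost + (q * (operationCost + operationCost) +
      (operationCost + operationCost))))
  testIICost = q′ * operationCost +
    length (templates (Γ-aux Γ)) * (q′ * (operationCost + operationCost))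
  binaryTypes = length (cartesianProduct (bits (binary vocabulary)) (bits (binary vocabulary)))
  -- The summands are the `suc` in the tick, the `n * m` state matrix, and the record of one pair,
  -- of which there are at most n².
  keyCost = record-bit * (1 + (m + (1 + binaryTypes * (2 * binary vocabulary))))
  stageIICost = step + (binaryTypes * (step + testIICost) + step)
  callIICost = keyCost + (keyCost + stageIICost)
  -- The last summand serves the base case, where Stage I hands over to Stage II.
  stageICost = step + (q * (step + testICost) + step) + callIICost

  opaque
    -- One edge can pay for a recursive call of either stage, a scan of at most `q` expanded types,
    -- and four steps: three for the outer node of a branch with its two edges, one for its node of
    -- literals. Being opaque, it stays a single symbol in the arithmetic, known only through
    -- `edgePrice-covers`.
    edgePrice : ℕ
    edgePrice = stageICost + q * step + 4 * step

    edgePrice-covers : stageICost + q * step + 4 * step ≤ edgePrice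
    edgePrice-covers = ≤-refl

-- Amortised accounts and their composition.

module Analysis (Γ : ScottNF) (κ : Costs) (n : ℕ) .{{_ : NonZero n}} where
  open ScottNF Γ
  open Types Γ
  open Costs κ
  open Compilation Γ κ n
  open Configurations
  open Overheads Γ κ

  N : ℕ
  N = n ^ 2

  n*n≤N : n * n ≤ N
  n*n≤N = ≤-reflexive (cong (n *_) (sym (*-identityʳ n)))

  n≤N : n ≤ N
  n≤N = ≤-trans (m≤m*n n n) n*n≤N

  -- Here the domain must be non-empty: constant times are rounded up to multiples of n².
  1≤N : 1 ≤ N
  1≤N = m^n>0 n 2

  ≤-*N : ∀ x → x ≤ x * N
  ≤-*N x = ≤-trans (≤-reflexive (sym (*-identityʳ x))) (*-monoʳ-≤ x 1≤N)

  -- Amortised time: ids are the gates awaiting a parent, and a is the time not charged to edges.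
  record Account (ids : List ℕ) (a : ℕ) (s : State) : Set where
    constructor account
    field
      reachable : AllReachable ids (gates s)
      paid      : time s ≤ (edgePrice * edges (gates s) + a) * N

  -- Reachability is monotone in the roots, so any identifier may be announced as a further root.
  -- This is what makes reuse harmless.
  Account-weaken : ∀ {ids ids′ a b s} → ids ⊆ ids′ → a ≤ b → Account ids a s → Account ids′ b s
  Account-weaken {s = s} ids⊆ids′ a≤b (account reachable paid) = account
    (AllReachable-⊆ (gates s) ids⊆ids′ reachable)
    (≤-trans paid (*-monoˡ-≤ N (+-monoʳ-≤ (edgePrice * edges (gates s)) a≤b)))

  -- The quantification over ids is a frame: p must not orphan the gates awaiting a parent.
  record Yields (roots : A → List ℕ) (x : ℕ) (p : M A) : Set where
    constructor yields
    field
      spec : ∀ {ids a s} → Account ids a s →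
             let r , s′ = p s in Account (roots r ++ ids) (x + a) s′
  open Yields

  Spends : ℕ → M A → Set
  Spends = Yields (const [])

  Builds : ℕ → M ℕ → Set
  Builds = Yields [_]

  Yields-≤ : ∀ {x y} {roots : A → List ℕ} {p} → x ≤ y → Yields roots x p → Yields roots y p
  Yields-≤ x≤y p⟨x⟩ = yields λ {_} {a} acc →
    Account-weaken ⊆-refl (+-monoˡ-≤ a x≤y) (spec p⟨x⟩ acc)

  return-yields : ∀ {x} {roots : A → List ℕ} {a} → Yields roots x (return a)
  return-yields = yields (Account-weaken (xs⊆ys++xs _ _) (m≤n+m _ _))

  if-yields : ∀ {x} {roots : A → List ℕ} {p p′ : M A} b → Yields roots x p → Yields roots x p′ →
              Yields roots x (if b then p else p′)
  if-yields true  p⟨x⟩ p′⟨x⟩ = p⟨x⟩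
  if-yields false p⟨x⟩ p′⟨x⟩ = p′⟨x⟩

  respend : ∀ {ids a b s} → a ≡ b → Account ids a s → Account ids b s
  respend a≡b = Account-weaken ⊆-refl (≤-reflexive a≡b)

  -- Every `spec` puts its cost in front, so a sequence of actions accumulates costs in reverse; the
  -- regroupings restore program order.
  regroup₂ : ∀ x y a → y + (x + a) ≡ x + y + a
  regroup₂ = solve-∀

  regroup₃ : ∀ x y z a → z + (y + (x + a)) ≡ x + (y + z) + a
  regroup₃ = solve-∀

  paid-more : ∀ t time x a e → t ≤ x * N → time ≤ (e + a) * N → t + time ≤ (e + (x + a)) * N
  paid-more t time x a e t≤xN paid =
    ≤-trans (+-mono-≤ t≤xN paid) (≤-reflexive (regroup x a e N))
    where
    regroup : ∀ x a e N → x * N + (e + a) * N ≡ (e + (x + a)) * N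
    regroup = solve-∀

  tick-spends : ∀ {t x} → t ≤ x * N → Spends x (tick t)
  tick-spends {t} {x} t≤xN = yields λ {_} {a} {s} (account reachable paid) →
    account reachable (paid-more t (time s) x a (edgePrice * edges (gates s)) t≤xN paid)

  step-spends : Spends step (tick step)
  step-spends = tick-spends (≤-*N step)

  -- Cost of the extendability tests.

  operation-account : ∀ {ids a s} → Account ids a s →
                      Account ids (operationCost + a) (proj₂ (tick (arith * suc ⌊log₂ n ⌋) s))
  operation-account = spec (tick-spends bound)
    where
    bound : arith * suc ⌊log₂ n ⌋ ≤ arith * 2 * N
    -- `2 * N` unfolds to `N + (N + 0)`: the first `N` absorbs the `suc`, the rest the logarithm.
    bound = ≤-trans (*-monoʳ-≤ arith (+-mono-≤ 1≤N (≤-trans (⌊log₂n⌋≤n n) (≤-trans n≤N (m≤m+n N 0)))))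
                    (≤-reflexive (sym (*-assoc arith 2 N)))

  operation-spends : (a : A) → Spends operationCost (operation a)
  operation-spends a = yields operation-account

  -- The list comes from a vector, so its length is known from its type; in the tests this is the
  -- number of unary types, independent of `n`.
  allM-spends : ∀ {k x} {p : A → M Bool} (as : Vec A k) → (∀ a → Spends x (p a)) →
                Spends (k * x) (allM p (toList as))
  allM-spends         []       p⟨x⟩ = return-yields
  allM-spends {x = x} (a ∷ as) p⟨x⟩ = yields λ acc →
    respend (regroup₂ x _ _) (spec (allM-spends as p⟨x⟩) (spec (p⟨x⟩ a) acc))

  anyM-spends : ∀ {x} {p : A → M Bool} as → (∀ a → Spends x (p a)) → Spends (length as * x) (anyM p as)
  anyM-spends         []       p⟨x⟩ = return-yields
  anyM-spends {x = x} (a ∷ as) p⟨x⟩ = yields λ acc →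
    respend (regroup₂ x _ _) (spec (anyM-spends as p⟨x⟩) (spec (p⟨x⟩ a) acc))

  counters-spends : ∀ {k} (cs : Vec ℕ k) → Spends (k * operationCost) (counters cs)
  counters-spends []       = return-yields
  counters-spends (c ∷ cs) = yields λ acc →
    respend (regroup₂ operationCost _ _) (spec (counters-spends cs) (operation-account acc))

  total-spends : ∀ {k} (cs : Vec ℕ k) → Spends (k * operationCost) (total (toList cs))
  total-spends []       = return-yields
  total-spends (c ∷ cs) = yields λ acc →
    respend (sym (+-assoc operationCost _ _)) (operation-account (spec (total-spends cs) acc))

  deficit-spends : ∀ {k} (ps : Vec (ℕ × ℕ) k) →
                   Spends (k * (operationCost + operationCost)) (deficit (toList ps))
  deficit-spends []             = return-yields
  deficit-spends ((t , c) ∷ ps) = yields λ acc →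
    respend (regroup operationCost _ _)
      (operation-account (spec (deficit-spends ps) (operation-account acc)))
    where
    regroup : ∀ x y a → x + (y + (x + a)) ≡ x + x + y + a
    regroup = solve-∀

  supports-spends : ∀ tc → Spends (operationCost + operationCost) (supports tc)
  supports-spends (t , c) = yields λ acc → respend (regroup₂ operationCost operationCost _)
    (spec (if-yields (t ≡ᵇ 0) (operation-spends (c ≡ᵇ 0)) return-yields)
          (operation-account acc))

  covers-spends : ∀ tc → Spends (operationCost + operationCost) (covers tc)
  covers-spends (t , c) = yields λ acc → respend (regroup₂ operationCost operationCost _)
    (spec (if-yields (t ≡ᵇ 0) (operation-spends (c ≡ᵇ 0)) (operation-spends (t ≤ᵇ c)))
          (operation-account acc))

  -- A configuration has one counter per unary type and the list of templates is fixed by the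
  -- sentence, so the context does not influence the bound.
  extendableI-spends : ∀ τs → Spends testICost (extendableI τs)
  extendableI-spends τs = yields λ {_} {_} {s₀} acc →
    let n̂ , _ = counters (configurationOf Γ τs) s₀ in
    respend (regroup₂ (q * operationCost) _ _)
    (spec (anyM-spends (templates Γ) λ n′ → yields λ acc →
             respend (regroup operationCost (q * (operationCost + operationCost)) (q * operationCost)
                        (q * (operationCost + operationCost)) _)
               (operation-account (operation-account
                 (spec (deficit-spends (Vec.zip n′ n̂)) (spec (total-spends n̂)
                   (spec (allM-spends (Vec.zip n′ n̂) supports-spends) acc))))))
          (spec (counters-spends (configurationOf Γ τs)) acc))
    where
    regroup : ∀ o x y z a → o + (o + (z + (y + (x + a)))) ≡ x + (y + (z + (o + o))) + a
    regroup = solve-∀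

  extendableII-spends : ∀ θ ij → Spends testIICost (extendableII θ ij)
  extendableII-spends θ ij = yields λ acc → respend (regroup₂ (Types.q (Γ-aux Γ) * operationCost) _ _)
    (spec (anyM-spends (templates (Γ-aux Γ)) λ n′ → allM-spends (Vec.zip n′ _) covers-spends)
          (spec (counters-spends (configurationOf (Γ-aux Γ) (auxTypes θ ij))) acc))

  -- Creating gates.

  step≤edgePrice : step ≤ edgePrice
  step≤edgePrice = ≤-trans (m≤m+n step _)
    (≤-trans (m≤n+m (4 * step) (stageICost + q * step)) edgePrice-covers)

  -- The children of `g` stop waiting because `g` now leads to them, and `g` waits in their place.
  -- The budget rises by `edgePrice` per new edge, which the second hypothesis sets against the time
  -- of writing `g` and the cost released from `a`.
  newGate-account : ∀ {ids ids′ a b s} g → ids ⊆ gateIds (children g) ++ ids′ →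
    step * suc (length (children g)) + a ≤ edgePrice * length (children g) + b →
    Account ids a s → let i , s′ = newGate g s in Account (i ∷ ids′) b s′
  newGate-account {ids} {ids′} {a} {b} {s} g ids⊆ a≤b (account reachable paid) = account
    (here refl , AllReachable-⊆ (gates s)
      (⊆-trans ids⊆ (++⁺ʳ (gateIds (children g)) (xs⊆x∷xs ids′ _))) reachable)
    (≤-trans (paid-more _ (time s) (step * suc l) a (edgePrice * edges (gates s))
                        (≤-*N (step * suc l)) paid)
      (*-monoˡ-≤ N (≤-trans (+-monoʳ-≤ (edgePrice * edges (gates s)) a≤b)
                            (≤-reflexive (regroup edgePrice (edges (gates s)) l b)))))
    where
    l = length (children g)
    regroup : ∀ w e l b → w * e + (w * l + b) ≡ w * (l + e) + b
    regroup = solve-∀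

  -- Each edge pays for writing itself, leaving one step for the gate.
  gate-price : ∀ l a → step * suc l + a ≤ edgePrice * l + (step + a)
  gate-price l a = ≤-trans (≤-reflexive (regroup step l a))
    (+-monoˡ-≤ (step + a) (*-monoˡ-≤ l step≤edgePrice))
    where
    regroup : ∀ x l a → x * suc l + a ≡ x * l + (x + a)
    regroup = solve-∀

  -- The two edges leaving the new node pay for it and for the call that produced i, of cost x.
  branch-account : ∀ {ids a x s} ls i → x + 4 * step ≤ edgePrice → Account (i ∷ ids) (x + a) s →
                   let b , s′ = branch ls i s in Account (b ∷ ids) a s′
  branch-account {ids} {a} {x} {s} ls i price acc =
    newGate-account (and (gate (length (gates s)) ∷ gate i ∷ [])) ⊆-refl
      (≤-trans (≤-reflexive (regroup step x a))
               (+-monoˡ-≤ a (≤-trans price (m≤m*n edgePrice 2))))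
      (newGate-account (and ls) (xs⊆ys++xs _ (gateIds ls)) (gate-price (length ls) (x + a)) acc)
    where
    regroup : ∀ y x a → y * 3 + (y + (x + a)) ≡ x + 4 * y + a
    regroup = solve-∀

  -- While the siblings are built, `b` is kept in their frame and so ends up behind them; `shift`
  -- moves it to the front.
  branch-then-account : ∀ {ids a x y s} {p : M (List (Child vocabulary n))} ls i →
    x + 4 * step ≤ edgePrice → Yields gateIds y p → Account (i ∷ ids) (x + a) s →
    let b , s′ = branch ls i s ; bs , s″ = p s′ in Account (b ∷ gateIds bs ++ ids) (y + a) s″
  branch-then-account ls i price p⟨y⟩ acc =
    Account-weaken (⊆-reflexive-↭ (shift _ _ _)) ≤-refl (spec p⟨y⟩ (branch-account ls i price acc))

  -- Branching over types.

  findReusable-spends : ∀ τ done → Spends (length done * step) (findReusable τ done)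
  findReusable-spends τ []                = return-yields
  findReusable-spends τ ((τ′ , s) ∷ done) = yields λ acc →
    respend (regroup₂ step _ _)
      (spec (if-yields (does (abstraction τ ≟ᵃ abstraction τ′)) return-yields (findReusable-spends τ done))
            (spec step-spends acc))

  regroup-branch : ∀ x t y a → y + (t + (x + a)) ≡ x + t + y + a
  regroup-branch = solve-∀

  module _ {test : Type → M Bool} {recurse : Type → M ℕ} {literals : Type → List (Child vocabulary n)}
           {t x d} (price : x + d * step + 4 * step ≤ edgePrice)
           (test-spends : ∀ τ → Spends t (test τ)) (recurse-builds : ∀ τ → Builds x (recurse τ)) where

    -- Expanding a type moves it from `τs` to `done` and rejecting it drops it, so `d` bounds every
    -- scan. Scan, recursion and nodes are charged to the edges of the branch; the loop step and the
    -- test stay with the caller, as a rejected type creates no edge.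
    branchesI-yields : ∀ τs done → length τs + length done ≤ d →
      Yields gateIds (length τs * (step + t)) (branchesI test recurse literals τs done)
    branchesI-yields []       done _  = return-yields
    branchesI-yields (τ ∷ τs) done ≤d = yields cons-account
      where
      rest-yields : ∀ i → Yields gateIds (length τs * (step + t))
                                 (branchesI test recurse literals τs ((τ , i) ∷ done))
      rest-yields i = branchesI-yields τs ((τ , i) ∷ done) (≤-trans (≤-reflexive (+-suc _ _)) ≤d)

      cons-account : ∀ {ids a s} → Account ids a s →
        let bs , s′ = branchesI test recurse literals (τ ∷ τs) done s in
        Account (gateIds bs ++ ids) (length (τ ∷ τs) * (step + t) + a) s′
      cons-account {s = s} acc
        with test τ (proj₂ (tick step s)) | spec (test-spends τ) (spec step-spends acc)
      ... | false , s₁ | acc₁ = respend (regroup-branch step t _ _)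
        (spec (branchesI-yields τs done (≤-trans (n≤1+n _) ≤d)) acc₁)
      ... | true , s₁ | acc₁
        with findReusable τ done s₁
           | spec (Yields-≤ (*-monoˡ-≤ step (m+n≤o⇒n≤o (suc (length τs)) ≤d))
                            (findReusable-spends τ done)) acc₁
      -- The reused `i` is announced as a root without any knowledge of `done`; the `x` reserved for
      -- a recursive call is left as slack.
      ... | just i , s₂ | acc₂ = respend (regroup-branch step t _ _)
        (branch-then-account {x = x + d * step} (literals τ) i price (rest-yields i)
          (respend (sym (+-assoc x (d * step) _)) (Account-weaken (xs⊆x∷xs _ i) (m≤n+m _ x) acc₂)))
      ... | nothing , s₂ | acc₂ = respend (regroup-branch step t _ _)
        (branch-then-account {x = x + d * step} (literals τ) _ price (rest-yields _)
          (respend (sym (+-assoc x (d * step) _)) (spec (recurse-builds τ) acc₂)))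

  module _ {test : BinaryType vocabulary → M Bool} {recurse : BinaryType vocabulary → M ℕ}
           {literals : BinaryType vocabulary → List (Child vocabulary n)}
           {t x} (price : x + 4 * step ≤ edgePrice)
           (test-spends : ∀ π → Spends t (test π)) (recurse-builds : ∀ π → Builds x (recurse π)) where

    branchesII-yields : ∀ πs → Yields gateIds (length πs * (step + t)) (branchesII test recurse literals πs)
    branchesII-yields []       = return-yields
    branchesII-yields (π ∷ πs) = yields λ {_} {_} {s} acc →
      respend (regroup-branch step t _ _)
        (spec (if-yields (proj₁ (test π (proj₂ (tick step s))))
                (yields λ acc → branch-then-account (literals π) _ price (branchesII-yields πs)
                  (spec (recurse-builds π) acc))
                (branchesII-yields πs))
              (spec (test-spends π) (spec step-spends acc)))

  -- Stage II.

  callII-price : callIICost + 4 * step ≤ edgePrice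
  callII-price = ≤-trans
    (+-monoˡ-≤ (4 * step) (≤-trans (m≤n+m callIICost (step + (q * (step + testICost) + step)))
                                   (m≤m+n stageICost (q * step))))
    edgePrice-covers

  length-𝓑 : ∀ τ τ′ → length (𝓑 τ τ′) ≤ binaryTypes
  length-𝓑 τ τ′ =
    List.length-filter _ (cartesianProduct (bits (binary vocabulary)) (bits (binary vocabulary)))

  -- Up to n² unprocessed pairs are recorded, each with a set whose size is bounded by the
  -- vocabulary; the state matrix is only linear in `n`.
  keySize-bound : ∀ ps θ → length ps ≤ n * n →
                  record-bit * suc (keySize (keyOf ps θ)) ≤ keyCost * N
  keySize-bound ps θ ≤n*n = ≤-trans
    (*-monoʳ-≤ record-bit (≤-trans
      (+-mono-≤ 1≤N (+-mono-≤ (*-monoˡ-≤ m n≤N) sets-bound))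
      (≤-reflexive (regroup N m recordSize))))
    (≤-reflexive (sym (*-assoc record-bit _ N)))
    where
    recordSize = 1 + binaryTypes * (2 * binary vocabulary)
    regroup : ∀ N m r → N + (N * m + N * r) ≡ (1 + (m + r)) * N
    regroup = solve-∀
    sets-bound : sum (map (λ (_ , πs) → 1 + length πs * (2 * binary vocabulary)) (Key.sets (keyOf ps θ)))
                 ≤ N * recordSize
    sets-bound = ≤-trans
      (≤-reflexive (cong sum (sym (List.map-∘ ps))))
      (≤-trans (sum-map-≤ {b = recordSize} _ ps λ (i , j) →
                  +-monoʳ-≤ 1 (*-monoˡ-≤ (2 * binary vocabulary) (length-𝓑 _ _)))
               (*-monoˡ-≤ recordSize (≤-trans ≤n*n n*n≤N)))

  retrieve-spends : ∀ {x} k → record-bit * suc (keySize k) ≤ x * N → Spends x (retrieve k)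
  retrieve-spends {x} k bound = yields λ acc →
    let account reachable paid = spec (tick-spends {x = x} bound) acc in account reachable paid

  -- An account speaks only of gates and time, so it is unpacked and repacked across the change of
  -- table.
  store-spends : ∀ {x} k i → record-bit * suc (keySize k) ≤ x * N → Spends x (store k i)
  store-spends {x} k i bound = yields λ acc →
    let account reachable paid = spec (tick-spends {x = x} bound) acc in account reachable paid

  callII-from-stageII : ∀ {x y} ps θ → record-bit * suc (keySize (keyOf ps θ)) ≤ x * N →
                        Builds y (stageII ps θ) → Builds (x + (x + y)) (callII ps θ)
  callII-from-stageII {x} {y} ps θ bound stageII⟨y⟩ = yields call-account
    where
    regroup : ∀ x y a → x + (y + (x + a)) ≡ x + (x + y) + a
    regroup = solve-∀
    call-account : ∀ {ids a s} → Account ids a s →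
      let i , s′ = callII ps θ s in Account (i ∷ ids) (x + (x + y) + a) s′
    call-account {a = a} {s} acc
      with lookupKey (keyOf ps θ) (table s) | spec (retrieve-spends {x} (keyOf ps θ) bound) acc
    -- No invariant of the table is needed: whatever identifier it returns is added as a root, and
    -- only the lookup has been spent.
    ... | just i  | acc₁ = Account-weaken (xs⊆x∷xs _ i) (+-monoˡ-≤ a (m≤m+n x (x + y))) acc₁
    ... | nothing | acc₁ = respend (regroup x y a)
      (spec (store-spends {x} (keyOf ps θ) _ bound) (spec stageII⟨y⟩ acc₁))

  -- The leaf has no edges to charge, so both steps fall to the caller.
  stageII-[] : ∀ θ → Builds (step + step) (stageII [] θ)
  stageII-[] θ = yields λ {_} {a} acc → respend (sym (+-assoc step step a))
    (newGate-account (and []) ⊆-refl (gate-price 0 _) (spec step-spends acc))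

  -- The cost `x` of the calls below is absent from the conclusion, since each is paid by the edges
  -- of its branch. Hence costs do not build up with the depth of recursion.
  stageII-∷ : ∀ {x} i j ps θ → x + 4 * step ≤ edgePrice → (∀ θ → Builds x (callII ps θ)) →
              Builds (step + (binaryTypes * (step + testIICost) + step)) (stageII ((i , j) ∷ ps) θ)
  stageII-∷ i j ps θ price callII⟨x⟩ = yields λ acc →
    respend (regroup₃ step _ step _)
      (newGate-account (or _) ⊆-refl (gate-price _ _)
        (spec (Yields-≤ (*-monoˡ-≤ (step + testIICost) (length-𝓑 τᵢ τⱼ))
                (branchesII-yields {literals = binaryLiterals (i , j)} price
                   (λ π → extendableII-spends (extend π) (i , j))
                   (λ π → callII⟨x⟩ (extend π)) (𝓑 τᵢ τⱼ)))
              (spec step-spends acc)))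
    where
    τᵢ τⱼ : Type
    τᵢ = lookup (Context.types θ) i
    τⱼ = lookup (Context.types θ) j
    extend : BinaryType vocabulary → Context
    extend π = Context.types θ & (((i , j) , π) ∷ Context.links θ)

  mutual
    callII-builds : ∀ ps θ → length ps ≤ n * n → Builds callIICost (callII ps θ)
    callII-builds ps θ ≤n*n =
      callII-from-stageII {keyCost} ps θ (keySize-bound ps θ ≤n*n) (stageII-builds ps θ ≤n*n)

    stageII-builds : ∀ ps θ → length ps ≤ n * n → Builds stageIICost (stageII ps θ)
    stageII-builds []             θ _    = Yields-≤ (+-monoʳ-≤ step (m≤n+m step _)) (stageII-[] θ)
    stageII-builds ((i , j) ∷ ps) θ ≤n*n = stageII-∷ i j ps θ callII-price
      λ θ → callII-builds ps θ (≤-trans (n≤1+n _) ≤n*n)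

  -- Stage I.

  length-pairs : length pairs ≤ n * n
  length-pairs = ≤-trans (List.length-filter _ (cartesianProduct Δ Δ))
    (≤-reflexive (trans (length-cartesianProductWith _,_ Δ Δ)
      (cong₂ _*_ (List.length-tabulate {n = n} _) (List.length-tabulate {n = n} _))))

  -- No gate is created here, so the cost of the call passes on to the caller.
  stageI-zero : ∀ {i x} eq (θ : Vec Type i) → (∀ θ → Builds x (callII pairs θ)) →
                Builds (step + x) (stageI zero eq θ)
  stageI-zero {x = x} eq θ callII⟨x⟩ = yields λ {_} {a} acc →
    respend (regroup₂ step x a) (spec (callII⟨x⟩ _) (spec step-spends acc))

  stageI-suc : ∀ {i x} r eq (θ : Vec Type i) → x + q * step + 4 * step ≤ edgePrice →
               (∀ eq (θ : Vec Type (suc i)) → Builds x (stageI r eq θ)) →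
               Builds (step + (q * (step + testICost) + step)) (stageI (suc r) eq θ)
  stageI-suc r eq θ price stageI⟨x⟩ = yields λ acc →
    respend (regroup₃ step _ step _)
      (newGate-account (or _) ⊆-refl (gate-price _ _)
        (spec (branchesI-yields price (λ τ → extendableI-spends (toList (θ ∷ʳ τ)))
                                (λ τ → stageI⟨x⟩ _ (θ ∷ʳ τ))
                                -- Nothing has been expanded yet, so `d` is `q`, matching the term
                                -- `q * step` of the price.
                                𝓤 [] (≤-reflexive (+-identityʳ q)))
              (spec step-spends acc)))

  stageI-builds : ∀ {i} r (eq : i + r ≡ n) (θ : Vec Type i) → Builds stageICost (stageI r eq θ)
  stageI-builds zero    eq θ = Yields-≤ (+-monoˡ-≤ callIICost (m≤m+n step _))
    (stageI-zero eq θ λ θ → callII-builds pairs θ length-pairs)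
  stageI-builds (suc r) eq θ = Yields-≤ (m≤m+n _ callIICost)
    (stageI-suc r eq θ edgePrice-covers λ eq θ → stageI-builds r eq θ)

  -- The overall bound.

  result-account : ∀ {x} → Builds x (stageI n refl []) →
                   Account (proj₁ result ∷ []) (x + setup) (proj₂ result)
  result-account {x} stageI⟨x⟩ = respend (cong (x +_) (+-identityʳ setup))
    -- The initial frame is empty, which leaves the output as the only root at the end.
    (spec stageI⟨x⟩ (spec (tick-spends {x = setup} (≤-*N setup)) (account tt z≤n)))

  -- With the output as sole root, `edges` equals the circuit size; the uncharged `a` is absorbed by
  -- the `+ 1`, which matters when the circuit has no edges.
  Account-bound : ∀ {i a s} → Account (i ∷ []) a s →
                  time s ≤ (edgePrice + a) * ((size (circuit (gates s) i) + 1) * N)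
  Account-bound {i} {a} {s} (account reachable paid) = ≤-trans paid
    (≤-trans (*-monoˡ-≤ N price) (≤-reflexive (*-assoc (edgePrice + a) (e + 1) N)))
    where
    e : ℕ
    e = size (circuit (gates s) i)
    regroup : ∀ w e a → w * e + a + (w + a * e) ≡ (w + a) * (e + 1)
    regroup = solve-∀
    price : edgePrice * edges (gates s) + a ≤ (edgePrice + a) * (e + 1)
    price = ≤-trans
      (+-monoˡ-≤ a (*-monoʳ-≤ edgePrice
        (≤-reflexive (sym (edgesFrom-AllReachable (gates s) reachable)))))
      (≤-trans (m≤m+n _ (edgePrice + a * e)) (≤-reflexive (regroup edgePrice e a)))

  runningTime-bound : runningTime ≤ (edgePrice + (stageICost + setup)) * ((size outputCircuit + 1) * n ^ 2)
  runningTime-bound = Account-bound (result-account (stageI-builds n refl []))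

theorem24 : (Γ : ScottNF) (κ : Costs) → ∃[ c ] ((n : ℕ) .{{_ : NonZero n}} →
    let open Compilation Γ κ n in
    runningTime ≤ c * ((size outputCircuit + 1) * n ^ 2))
-- The constant is built from `Overheads`, which does not take `n` as a parameter.
theorem24 Γ κ = Overheads.edgePrice Γ κ + (Overheads.stageICost Γ κ + Costs.setup κ) ,
  λ n → Analysis.runningTime-bound Γ κ n
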